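{- For all integers $r \ge 2$ and $n \ge 1$, $$\left|\mathrm{Cyc}_r(n)\right| \le \left|\mathrm{Reg}_r(n)\right|,$$ where equality holds only when $r=2$ and $n$ is even.
   Context: Permutations of $[n]=\{1,\dots,n\}$ are viewed through their disjoint cycle decompositions, fixed points counting as cycles of length $1$. $\mathrm{Reg}_r(n)$ is the set of permutations of $[n]$ none of whose cycle lengths is divisible by $r$. $\mathrm{Cyc}_r(n)$ is the set of permutations of $[n]$ all of whose cycle lengths are divisible by $r$. -}

module Defs where

open import Data.Fin.Base using (Fin)
open import Data.Fin.Permutation using (Permutation′; _⟨$⟩ʳ_; _≈_)
open import Data.List.Base as List using (_∷_; _∷ʳ_)
open import Data.List.NonEmpty.Base using (List⁺; _∷_; length)
open import Data.List.Relation.Unary.Unique.Propositional using (Unique)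
open import Data.Nat.Base using (ℕ)
open import Data.Nat.Divisibility using (_∣_; _∤_)
open import Data.Product.Base using (Σ; _×_; proj₁)
open import Function.Bundles using (Inverse)
open import Level using (0ℓ)
open import Relation.Binary.Bundles using (Setoid)
import Relation.Binary.Construct.On as On
open import Relation.Binary.PropositionalEquality as ≡ using (_≡_)

-- (x₀ x₁ … xₖ) is a cycle of π: its entries are distinct and π sends
-- x₀ ↦ x₁ ↦ … ↦ xₖ ↦ x₀. Up to the choice of the starting point x₀, these
-- are exactly the factors of the disjoint cycle decomposition of π; a fixed
-- point x gives the cycle (x) of length 1.
IsCycle : ∀ {n} → Permutation′ n → List⁺ (Fin n) → Set
IsCycle π (x ∷ xs) =
  Unique (x ∷ xs) × List.map (π ⟨$⟩ʳ_) (x ∷ xs) ≡ xs ∷ʳ x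

IsRegular : ∀ {n} → ℕ → Permutation′ n → Set
IsRegular r π = ∀ c → IsCycle π c → r ∤ length c

IsCyclic : ∀ {n} → ℕ → Permutation′ n → Set
IsCyclic r π = ∀ c → IsCycle π c → r ∣ length c

permSetoid : ℕ → Setoid 0ℓ 0ℓ
permSetoid n = record
  { Carrier       = Permutation′ n
  ; _≈_           = _≈_
  ; isEquivalence = record
    { refl  = λ i → ≡.refl
    ; sym   = λ π≈ρ i → ≡.sym (π≈ρ i)
    ; trans = λ π≈ρ ρ≈σ i → ≡.trans (π≈ρ i) (ρ≈σ i)
    }
  }

-- Two elements of these sets are equal when they are equal as maps; neither
-- the recorded inverse nor the proof of membership matters. The set [n] is
-- represented by Fin n.
Reg : ℕ → ℕ → Setoid 0ℓ 0ℓ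
Reg r n = On.setoid {B = Σ (Permutation′ n) (IsRegular r)} (permSetoid n) proj₁

Cyc : ℕ → ℕ → Setoid 0ℓ 0ℓ
Cyc r n = On.setoid {B = Σ (Permutation′ n) (IsCyclic r)} (permSetoid n) proj₁

HasCardinality : Setoid 0ℓ 0ℓ → ℕ → Set
HasCardinality S k = Inverse S (≡.setoid (Fin k))

{-# OPTIONS --safe #-}

-- Deleting a point a from its cycle and crediting its weight to the predecessor
-- of a preserves the total weight of every cycle. Counting permutations by cycle
-- weight, with one marked point of weight j and m further points of weight 1,
-- and deleting the marked point, gives the recursion
--
--   marked m j = [j admissible] total m + m · marked (m − 1) (j + 1)
--
-- with total m = marked (m − 1) 1: the marked point is alone in its cycle, or
-- one of the m others is its predecessor and becomes the marked point.
-- For r-regular permutations this yields total m = m · total (m − 1) when r ∤ m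
-- and total m = (m − 1) · total (m − 1) when r ∣ m. For cycle lengths divisible
-- by r, total m is 0 when r ∤ m; when r ∣ m, passing from m − r to m multiplies
-- it by (m − 1)(m − 2)⋯(m − r + 1) · (m − r + 1), against
-- (m − 1) · (m − 1)(m − 2)⋯(m − r + 1) in the regular case, which is larger
-- unless r = 2.
module Submission where

open import Defs
open import Data.Bool.Base using (if_then_else_; not)
open import Data.Empty using (⊥-elim)
open import Data.Fin.Base using (Fin; punchIn; punchOut)
open import Data.Fin.Patterns using (0F)
open import Data.Fin.Permutation using
  (Permutation′; _⟨$⟩ʳ_; _⟨$⟩ˡ_; _≈_; _∘ₚ_; id; transpose; insert; remove;
   inverseʳ; insert-punchIn; insert-remove)
open import Data.Fin.Permutation.Components using (transpose-inverse)
open import Data.Fin.Properties using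
  (_≟_; punchIn-injective; punchInᵢ≢i; punchIn-punchOut; +↔⊎; *↔×)
open import Data.List.Base as List using (List; []; _∷_; _∷ʳ_)
open import Data.List.Membership.Propositional using (_∈_)
open import Data.List.NonEmpty.Base as List⁺ using (_∷_)
open import Data.List.Properties using (∷-injective)
open import Data.List.Relation.Unary.All as All using (All; []; _∷_)
open import Data.List.Relation.Unary.AllPairs using ([]; _∷_)
open import Data.List.Relation.Unary.Any using (here; there)
open import Data.List.Relation.Unary.Unique.Propositional using (Unique)
open import Data.Nat.Base using (ℕ; zero; suc; _+_; _*_; _≤_; _<_; z≤n; s≤s)
open import Data.Nat.Divisibility using
  (_∣_; _∤_; _∣?_; ∣-refl; ∣m+n∣m⇒∣n; ∣m∣n⇒∣m+n; n∣m*n; >⇒∤; divides-refl)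
open import Data.Nat.Properties as ℕ using
  (+-assoc; +-comm; +-identityʳ; +-suc; *-zeroʳ; *-monoʳ-≤; *-monoʳ-<;
   ≤-refl; ≤-trans; ≤-antisym; ≤-reflexive; <⇒≤; <⇒≢; ≤∧≢⇒<; 1+n≰n;
   m≤n⇒m≤1+n; m≤m+n; m≤n+m; m<n+m; m+n≤o⇒n≤o; module ≤-Reasoning)
open import Algebra.Properties.CommutativeSemigroup ℕ.*-commutativeSemigroup
  using (x∙yz≈y∙xz)
open import Data.Product.Base using (Σ; ∃; ∃₂; _×_; _,_; proj₁; proj₂; map₂)
open import Data.Product.Relation.Binary.Pointwise.NonDependent using (×-setoid)
open import Data.Sum.Base using (inj₁; inj₂)
open import Data.Sum.Function.Setoid using (_⊎-inverse_)
open import Data.Sum.Relation.Binary.Pointwise as Sum using (⊎-setoid; inj₁; inj₂)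
open import Function.Base using (_∘_; const)
open import Function.Bundles using (Inverse; Bijection; Injection; mk⇔)
open import Function.Definitions using (Injective)
open import Function.Properties.Bijection using (Bijection⇒Inverse)
import Function.Properties.Inverse as Inverse
open import Level using (0ℓ)
open import Relation.Binary.Bundles using (Setoid)
import Relation.Binary.Construct.On as On
open import Relation.Binary.PropositionalEquality as ≡ using
  (_≡_; _≢_; refl; sym; trans; cong; cong₂; subst; module ≡-Reasoning)
open import Relation.Nullary using (¬_; ¬?; yes; no; does; contradiction)
open import Relation.Nullary.Decidable using (dec-true; dec-false; does-⇔)
open import Relation.Unary using (Decidable)

-- Weighted cycles of a map.

-- Path f w x z s: iterating f from z leads to x, and s is the total weight of
-- the points met before the first arrival at x; z itself counts even if z ≡ x.
data Path {n} (f : Fin n → Fin n) (w : Fin n → ℕ) (x : Fin n) :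
          Fin n → ℕ → Set where
  arrive : ∀ {z} → f z ≡ x → Path f w x z (w z)
  step   : ∀ {z s} → f z ≢ x → Path f w x (f z) s → Path f w x z (w z + s)

-- A path from `x` back to `x` goes once around its cycle, so `s` is the total weight of that cycle;
-- with weight 1 everywhere it is the cycle length.
Balanced : ∀ {n} → (ℕ → Set) → (Fin n → ℕ) → Permutation′ n → Set
Balanced P w π = ∀ x s → Path (π ⟨$⟩ʳ_) w x x s → P s

module _ {n} {f : Fin n → Fin n} {w : Fin n → ℕ} where

  path-deterministic : ∀ {x z s t} → Path f w x z s → Path f w x z t → s ≡ t
  path-deterministic (arrive _)   (arrive _)   = refl
  path-deterministic (arrive e)   (step ne _)  = contradiction e ne
  path-deterministic (step ne _)  (arrive e)   = contradiction e ne
  path-deterministic (step _ p)   (step _ q)   = cong (w _ +_) (path-deterministic p q)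

  module _ (inj : Injective _≡_ _≡_ f) where

    -- By injectivity only `x` is sent to `f x`, so a path that first arrives at `x` from another
    -- point first arrives at `f x` exactly one step later.
    extend-path : ∀ {x z s} → f x ≢ x → z ≢ x → Path f w x z s →
                  Path f w (f x) z (s + w x)
    extend-path {x} {z} fx≢x z≢x (arrive fz≡x) =
      subst (λ y → Path f w (f x) z (w z + w y)) fz≡x
        (step (λ e → fx≢x (trans (sym e) fz≡x)) (arrive (cong f fz≡x)))
    extend-path {x} {z} fx≢x z≢x (step {s = s} fz≢x p) =
      subst (Path f w (f x) z) (sym (+-assoc (w z) s (w x)))
        (step (z≢x ∘ inj) (extend-path fx≢x fz≢x p))

    -- Cycle weight does not depend on the starting point. This serves the cycle through a point
    -- about to be deleted, which must be read from a surviving point.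
    rotate : ∀ {x s} → f x ≢ x → Path f w x x s → Path f w (f x) (f x) s
    rotate fx≢x (arrive e)             = contradiction e fx≢x
    rotate {x} fx≢x (step {s = s} ne p) =
      subst (Path f w (f x) (f x)) (+-comm s (w x)) (extend-path fx≢x ne p)

path-cong : ∀ {n} {f g : Fin n → Fin n} {w x z s} → (∀ y → f y ≡ g y) →
            Path f w x z s → Path g w x z s
path-cong f≗g (arrive e)  = arrive (trans (sym (f≗g _)) e)
path-cong f≗g (step ne p) =
  step (ne ∘ trans (f≗g _)) (subst (λ y → Path _ _ _ y _) (f≗g _) (path-cong f≗g p))

balanced-cong : ∀ {n P w} (π σ : Permutation′ n) → π ≈ σ → Balanced P w π → Balanced P w σ
balanced-cong π σ π≈σ b x s p = b x s (path-cong (sym ∘ π≈σ) p)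

-- Cycles as lists and as closed paths of weight 1.

module _ {n} {f : Fin n → Fin n} {x : Fin n} where

  -- For `z` equal to `x` this is `IsCycle` with distinctness asked only between `x` and the other
  -- entries; a free `z` allows induction along the list.
  Chain : Fin n → List (Fin n) → Set
  Chain z zs = All (x ≢_) zs × List.map f (z ∷ zs) ≡ zs ∷ʳ x

  chain⇒path : ∀ {z zs} → Chain z zs →
               Path f (const 1) x z (suc (List.length zs))
  chain⇒path {zs = []}     (_ , e)        = arrive (proj₁ (∷-injective e))
  chain⇒path {zs = y ∷ ys} (x≢y ∷ a , e) with refl , e′ ← ∷-injective e =
    step (x≢y ∘ sym) (chain⇒path (a , e′))

  path⇒chain : ∀ {z s} → Path f (const 1) x z s →
               ∃ λ zs → Chain z zs × s ≡ suc (List.length zs)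
  path⇒chain (arrive e)     = [] , ([] , cong (_∷ []) e) , refl
  path⇒chain {z} (step ne p) with zs , (a , e) , refl ← path⇒chain p =
    f z ∷ zs , (ne ∘ sym ∷ a , cong (f z ∷_) e) , refl

  chain-suffix : ∀ {y z zs} → y ∈ zs → Chain z zs →
                 ∃ λ s → s ≤ List.length zs × Path f (const 1) x y s
  chain-suffix (here refl) (_ ∷ a , e) =
    _ , ≤-refl , chain⇒path (a , proj₂ (∷-injective e))
  chain-suffix {zs = _ ∷ _} (there y∈) (_ ∷ a , e) with refl , e′ ← ∷-injective e
    with s , s≤ , p ← chain-suffix y∈ (a , e′) = s , m≤n⇒m≤1+n s≤ , p

  -- The second occurrence of a repeated entry would reach `x` in strictly fewer steps than the
  -- first, against `path-deterministic`.
  chain-unique : ∀ {z zs} → Chain z zs → Unique zs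
  chain-unique {zs = []}     _           = []
  chain-unique {zs = y ∷ ys} (_ ∷ a , e) with refl , e′ ← ∷-injective e =
    All.tabulate fresh ∷ chain-unique (a , e′)
    where
    fresh : ∀ {y′} → y′ ∈ ys → y ≢ y′
    fresh y∈ refl with s , s≤ , p ← chain-suffix y∈ (a , e′)
      with refl ← path-deterministic p (chain⇒path (a , e′)) = 1+n≰n s≤

module _ {n} {P : ℕ → Set} (π : Permutation′ n) where

  cycles⇒balanced : (∀ c → IsCycle π c → P (List⁺.length c)) →
                    Balanced P (const 1) π
  cycles⇒balanced h x s p with zs , c , refl ← path⇒chain p =
    h (x ∷ zs) ((proj₁ c ∷ chain-unique c) , proj₂ c)

  balanced⇒cycles : Balanced P (const 1) π →
                    ∀ c → IsCycle π c → P (List⁺.length c)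
  balanced⇒cycles b (x ∷ xs) (a ∷ _ , e) = b x _ (chain⇒path (a , e))

-- Cycle weights under deletion of a point.

record FixedExtension {m} (a : Fin (suc m)) (f : Fin (suc m) → Fin (suc m))
                      (g : Fin m → Fin m) : Set where
  field
    at-a : f a ≡ a
    else : ∀ x → f (punchIn a x) ≡ punchIn a (g x)

record CycleInsertion {m} (a : Fin (suc m)) (q : Fin m)
                      (f : Fin (suc m) → Fin (suc m)) (g : Fin m → Fin m) : Set where
  field
    at-q : f (punchIn a q) ≡ a
    at-a : f a ≡ punchIn a (g q)
    else : ∀ x → x ≢ q → f (punchIn a x) ≡ punchIn a (g x)

module _ {m} {a : Fin (suc m)} {f : Fin (suc m) → Fin (suc m)} {g : Fin m → Fin m}
         (F : FixedExtension a f g) {w : Fin (suc m) → ℕ} {u : Fin m → ℕ}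
         (u≡ : ∀ x → u x ≡ w (punchIn a x)) where
  open FixedExtension F

  extend-fixed : ∀ {x z s} → Path g u x z s → Path f w (punchIn a x) (punchIn a z) s
  extend-fixed {x} {z} (arrive e) =
    subst (Path f w _ _) (sym (u≡ z)) (arrive (trans (else z) (cong (punchIn a) e)))
  extend-fixed {x} {z} (step {s = s} ne p) =
    subst (λ t → Path f w _ _ (t + s)) (sym (u≡ z))
      (step (ne ∘ punchIn-injective a _ _ ∘ trans (sym (else z)))
        (subst (λ y → Path f w _ y s) (sym (else z)) (extend-fixed p)))

  -- The start `y` is tied to `punchIn a z` by an equation because after a step it is a value of
  -- `f`, of that form only propositionally.
  restrict-fixed : ∀ {x y z s} → y ≡ punchIn a z →
                   Path f w (punchIn a x) y s → Path g u x z s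
  restrict-fixed {x} {_} {z} refl (arrive e) =
    subst (Path g u _ _) (u≡ z) (arrive (punchIn-injective a _ _ (trans (sym (else z)) e)))
  restrict-fixed {x} {_} {z} refl (step {s = s} ne p) =
    subst (λ t → Path g u _ _ (t + s)) (u≡ z)
      (step (ne ∘ trans (else z) ∘ cong (punchIn a)) (restrict-fixed (else z) p))

module _ {m} {a : Fin (suc m)} {q : Fin m}
         {f : Fin (suc m) → Fin (suc m)} {g : Fin m → Fin m}
         (I : CycleInsertion a q f g) {w : Fin (suc m) → ℕ} {v : Fin m → ℕ}
         (v-q : v q ≡ w (punchIn a q) + w a)
         (v-else : ∀ x → x ≢ q → v x ≡ w (punchIn a x)) where
  open CycleInsertion I

  -- The single step of `g` from `q` becomes two steps of `f`, through `a`, and `v q` is the sum of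
  -- their weights; all other steps correspond one to one.
  insert-path : ∀ {x z s} → Path g v x z s → Path f w (punchIn a x) (punchIn a z) s
  insert-path {x} {z} p with z ≟ q
  insert-path {x} {z} (arrive e) | yes refl =
    subst (Path f w _ _) (sym v-q)
      (step (λ e′ → punchInᵢ≢i a x (trans (sym e′) at-q))
        (subst (λ y → Path f w _ y (w a)) (sym at-q)
          (arrive (trans at-a (cong (punchIn a) e)))))
  insert-path {x} {z} (step {s = s} ne p) | yes refl =
    subst (Path f w _ _) (sym (trans (cong (_+ s) v-q) (+-assoc (w (punchIn a q)) _ s)))
      (step (λ e′ → punchInᵢ≢i a x (trans (sym e′) at-q))
        (subst (λ y → Path f w _ y (w a + s)) (sym at-q)
          (step (ne ∘ punchIn-injective a _ _ ∘ trans (sym at-a))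
            (subst (λ y → Path f w _ y s) (sym at-a) (insert-path p)))))
  insert-path {x} {z} (arrive e) | no z≢q =
    subst (Path f w _ _) (sym (v-else z z≢q))
      (arrive (trans (else z z≢q) (cong (punchIn a) e)))
  insert-path {x} {z} (step {s = s} ne p) | no z≢q =
    subst (λ t → Path f w _ _ (t + s)) (sym (v-else z z≢q))
      (step (ne ∘ punchIn-injective a _ _ ∘ trans (sym (else z z≢q)))
        (subst (λ y → Path f w _ y s) (sym (else z z≢q)) (insert-path p)))

  contract-path : ∀ {x y z s} → y ≡ punchIn a z →
                  Path f w (punchIn a x) y s → Path g v x z s
  contract-path {x} {_} {z} refl p with z ≟ q
  contract-path {x} {_} {z} refl (arrive e) | yes refl =
    contradiction (trans (sym e) at-q) (punchInᵢ≢i a x)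
  contract-path {x} {_} {z} refl (step _ (arrive e)) | yes refl =
    subst (Path g v _ _) (trans v-q (cong (λ y → w (punchIn a q) + w y) (sym at-q)))
      (arrive (punchIn-injective a _ _ (trans (sym at-a) (trans (cong f (sym at-q)) e))))
  contract-path {x} {_} {z} refl (step _ (step {s = s} ne p)) | yes refl =
    subst (Path g v _ _)
      (trans (cong (_+ s) (trans v-q (cong (λ y → w (punchIn a q) + w y) (sym at-q))))
        (+-assoc (w (punchIn a q)) _ s))
      (step (λ e → ne (trans ffq (cong (punchIn a) e))) (contract-path ffq p))
    where
    ffq : f (f (punchIn a q)) ≡ punchIn a (g q)
    ffq = trans (cong f at-q) at-a
  contract-path {x} {_} {z} refl (arrive e) | no z≢q =
    subst (Path g v _ _) (v-else z z≢q)
      (arrive (punchIn-injective a _ _ (trans (sym (else z z≢q)) e)))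
  contract-path {x} {_} {z} refl (step {s = s} ne p) | no z≢q =
    subst (λ t → Path g v _ _ (t + s)) (v-else z z≢q)
      (step (ne ∘ trans (else z z≢q) ∘ cong (punchIn a)) (contract-path (else z z≢q) p))

permutation-injective : ∀ {n} (π : Permutation′ n) → Injective _≡_ _≡_ (π ⟨$⟩ʳ_)
permutation-injective π = Injection.injective (Inverse.Inverse⇒Injection π)

data PunchView {m} (a : Fin (suc m)) : Fin (suc m) → Set where
  hit  : PunchView a a
  miss : ∀ x → PunchView a (punchIn a x)

punchView : ∀ {m} (a y : Fin (suc m)) → PunchView a y
punchView a y with a ≟ y
... | yes refl = hit
... | no a≢y   = subst (PunchView a) (punchIn-punchOut a≢y) (miss (punchOut a≢y))

module _ {m} {P : ℕ → Set} {a : Fin (suc m)} (π : Permutation′ (suc m)) (ρ : Permutation′ m)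
         {w : Fin (suc m) → ℕ} where

  module _ (F : FixedExtension a (π ⟨$⟩ʳ_) (ρ ⟨$⟩ʳ_)) {u : Fin m → ℕ}
           (u≡ : ∀ x → u x ≡ w (punchIn a x)) where
    open FixedExtension F

    extend-balanced : P (w a) × Balanced P u ρ → Balanced P w π
    extend-balanced (pa , b) y s p with punchView a y
    ... | hit    = subst P (path-deterministic (arrive at-a) p) pa
    ... | miss x = b x s (restrict-fixed F u≡ refl p)

    restrict-balanced : Balanced P w π → P (w a) × Balanced P u ρ
    restrict-balanced b =
      b a (w a) (arrive at-a) , λ x s p → b _ s (extend-fixed F u≡ p)

  module _ {q : Fin m} (I : CycleInsertion a q (π ⟨$⟩ʳ_) (ρ ⟨$⟩ʳ_)) {v : Fin m → ℕ}
           (v-q : v q ≡ w (punchIn a q) + w a)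
           (v-else : ∀ x → x ≢ q → v x ≡ w (punchIn a x)) where
    open CycleInsertion I

    insert-balanced : Balanced P v ρ → Balanced P w π
    insert-balanced b y s p with punchView a y
    -- The cycle through `a` is read from the successor of `a`, which is the image under `punchIn a`
    -- of the successor of `q`.
    ... | hit    = b (ρ ⟨$⟩ʳ q) s (contract-path I v-q v-else refl
                     (subst (λ y → Path (π ⟨$⟩ʳ_) w y y s) at-a
                       (rotate (permutation-injective π)
                         (λ e → punchInᵢ≢i a _ (trans (sym at-a) e)) p)))
    ... | miss x = b x s (contract-path I v-q v-else refl p)

    contract-balanced : Balanced P w π → Balanced P v ρ
    contract-balanced b x s p = b _ s (insert-path I v-q v-else p)

-- Inserting and deleting a point by transpositions.

transpose-ˡ : ∀ {n} (i j : Fin n) → transpose i j ⟨$⟩ʳ i ≡ j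
transpose-ˡ i j rewrite dec-true (i ≟ i) refl = refl

transpose-ʳ : ∀ {n} (i j : Fin n) → transpose i j ⟨$⟩ʳ j ≡ i
transpose-ʳ i j with j ≟ i
... | yes e = e
... | no _ rewrite dec-true (j ≟ j) refl = refl

transpose-≢ : ∀ {n} {i j k : Fin n} → k ≢ i → k ≢ j → transpose i j ⟨$⟩ʳ k ≡ k
transpose-≢ {i = i} {j} {k} k≢i k≢j
  rewrite dec-false (k ≟ i) k≢i | dec-false (k ≟ j) k≢j = refl

insert-at : ∀ {m} (i j : Fin (suc m)) (ρ : Permutation′ m) → insert i j ρ ⟨$⟩ʳ i ≡ j
insert-at i j ρ with i ≟ i
... | yes _  = refl
... | no i≢i = contradiction refl i≢i

-- Inserts the new point a into the cycle of q, right after q.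
splice : ∀ {m} (a q : Fin (suc m)) → Permutation′ m → Permutation′ (suc m)
splice a q ρ = transpose a q ∘ₚ insert a a ρ

splice-q : ∀ {m} (a q : Fin (suc m)) ρ → splice a q ρ ⟨$⟩ʳ q ≡ a
splice-q a q ρ = trans (cong (insert a a ρ ⟨$⟩ʳ_) (transpose-ʳ a q)) (insert-at a a ρ)

-- The transposition of `a` with itself is trivial, so `a` becomes a fixed point. Thus the second
-- argument of `splice` is always the preimage of `a`.
splice-fixed : ∀ {m} (a : Fin (suc m)) ρ → FixedExtension a (splice a a ρ ⟨$⟩ʳ_) (ρ ⟨$⟩ʳ_)
splice-fixed a ρ = record
  { at-a = splice-q a a ρ
  ; else = λ x → trans
      (cong (insert a a ρ ⟨$⟩ʳ_) (transpose-≢ (punchInᵢ≢i a x) (punchInᵢ≢i a x)))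
      (insert-punchIn a a ρ x)
  }

splice-cycle : ∀ {m} (a : Fin (suc m)) q ρ →
               CycleInsertion a q (splice a (punchIn a q) ρ ⟨$⟩ʳ_) (ρ ⟨$⟩ʳ_)
splice-cycle a q ρ = record
  { at-q = splice-q a (punchIn a q) ρ
  ; at-a = trans (cong (insert a a ρ ⟨$⟩ʳ_) (transpose-ˡ a (punchIn a q)))
             (insert-punchIn a a ρ q)
  ; else = λ x x≢q → trans
      (cong (insert a a ρ ⟨$⟩ʳ_)
        (transpose-≢ (punchInᵢ≢i a x) (x≢q ∘ punchIn-injective a x q)))
      (insert-punchIn a a ρ x)
  }

splice-cong : ∀ {m} (a q : Fin (suc m)) {ρ σ : Permutation′ m} → ρ ≈ σ →
              splice a q ρ ≈ splice a q σ
splice-cong a q {ρ} {σ} ρ≈σ y = go (punchView a (transpose a q ⟨$⟩ʳ y))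
  where
  go : ∀ {z} → PunchView a z → insert a a ρ ⟨$⟩ʳ z ≡ insert a a σ ⟨$⟩ʳ z
  go hit      = trans (insert-at a a ρ) (sym (insert-at a a σ))
  go (miss x) = trans (insert-punchIn a a ρ x)
    (trans (cong (punchIn a) (ρ≈σ x)) (sym (insert-punchIn a a σ x)))

splice-injective-point : ∀ {m} (a : Fin (suc m)) {q q′} {ρ σ : Permutation′ m} →
                         splice a q ρ ≈ splice a q′ σ → q ≡ q′
splice-injective-point a {q} {q′} {ρ} {σ} e = permutation-injective (splice a q ρ)
  (trans (splice-q a q ρ) (sym (trans (e q′) (splice-q a q′ σ))))

splice-injective : ∀ {m} (a q : Fin (suc m)) {ρ σ : Permutation′ m} →
                   splice a q ρ ≈ splice a q σ → ρ ≈ σ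
splice-injective a q {ρ} {σ} e x = punchIn-injective a _ _ (begin
  punchIn a (ρ ⟨$⟩ʳ x)             ≡⟨ insert-punchIn a a ρ x ⟨
  insert a a ρ ⟨$⟩ʳ punchIn a x    ≡⟨ cong (insert a a ρ ⟨$⟩ʳ_) (transpose-inverse a q) ⟨
  splice a q ρ ⟨$⟩ʳ y              ≡⟨ e y ⟩
  splice a q σ ⟨$⟩ʳ y              ≡⟨ cong (insert a a σ ⟨$⟩ʳ_) (transpose-inverse a q) ⟩
  insert a a σ ⟨$⟩ʳ punchIn a x    ≡⟨ insert-punchIn a a σ x ⟩
  punchIn a (σ ⟨$⟩ʳ x)             ∎)
  where
  open ≡-Reasoning
  -- The point that the transposition inside `splice` sends to `punchIn a x`.
  y = transpose q a ⟨$⟩ʳ punchIn a x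

-- Composing `π` with the transposition of `a` and its preimage, applied first, makes `a` a fixed
-- point, which can then be removed.
splice-surjective : ∀ {m} (a : Fin (suc m)) (π : Permutation′ (suc m)) →
                    ∃ λ ρ → splice a (π ⟨$⟩ˡ a) ρ ≈ π
splice-surjective a π = remove a τ , λ y → begin
  insert a a (remove a τ) ⟨$⟩ʳ T y             ≡⟨ cong (λ b → insert a b (remove a τ) ⟨$⟩ʳ T y) τa ⟨
  insert a (τ ⟨$⟩ʳ a) (remove a τ) ⟨$⟩ʳ T y    ≡⟨ insert-remove a τ (T y) ⟩
  π ⟨$⟩ʳ (transpose q a ⟨$⟩ʳ T y)              ≡⟨ cong (π ⟨$⟩ʳ_) (transpose-inverse q a) ⟩
  π ⟨$⟩ʳ y                                     ∎
  where
  open ≡-Reasoning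
  q = π ⟨$⟩ˡ a
  T = transpose a q ⟨$⟩ʳ_
  τ = transpose q a ∘ₚ π
  τa : τ ⟨$⟩ʳ a ≡ a
  τa = trans (cong (π ⟨$⟩ʳ_) (transpose-ʳ q a)) (inverseʳ π)

-- Cardinalities of sets of permutations.

Perms : ∀ {n} → (Permutation′ n → Set) → Setoid 0ℓ 0ℓ
Perms {n} Q = On.setoid {B = Σ (Permutation′ n) Q} (permSetoid n) proj₁

IndexedPerms : ∀ {l m} → (Fin l → Permutation′ m → Set) → Setoid 0ℓ 0ℓ
IndexedPerms {l} {m} Q =
  On.setoid {B = Σ (Fin l × Permutation′ m) λ (q , ρ) → Q q ρ}
    (×-setoid (≡.setoid (Fin l)) (permSetoid m)) proj₁

cardinality-⊎ : ∀ {S T k l} → HasCardinality S k → HasCardinality T l →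
                HasCardinality (⊎-setoid S T) (k + l)
cardinality-⊎ s t = Inverse.trans (s ⊎-inverse t)
  (Inverse.trans (Sum.Pointwise-≡↔≡ _ _) (Inverse.sym +↔⊎))

module _ {n} {Q : Permutation′ n → Set} where

  perms-⇔ : ∀ {Q′} → (∀ π → Q π → Q′ π) → (∀ π → Q′ π → Q π) →
            Inverse (Perms Q) (Perms Q′)
  perms-⇔ to from = record
    { to        = map₂ (to _)
    ; from      = map₂ (from _)
    ; to-cong   = λ e → e
    ; from-cong = λ e → e
    ; inverse   = (λ e → e) , (λ e → e)
    }

  cardinality-none : (∀ π → ¬ Q π) → HasCardinality (Perms Q) 0
  cardinality-none ¬Q = record
    { to        = λ (_ , x) → ⊥-elim (¬Q _ x)
    ; from      = λ ()
    ; to-cong   = λ {x} _ → ⊥-elim (¬Q _ (proj₂ x))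
    ; from-cong = λ { {()} }
    ; inverse   = (λ { {()} }) , λ {x} _ → ⊥-elim (¬Q _ (proj₂ x))
    }

cardinality-one : {Q : Permutation′ 0 → Set} → (∀ π → Q π) → HasCardinality (Perms Q) 1
cardinality-one allQ = record
  { to        = const 0F
  ; from      = const (id , allQ _)
  ; to-cong   = const refl
  ; from-cong = λ _ ()
  ; inverse   = (λ { {0F} _ → refl }) , λ _ ()
  }

cardinality-indexed : ∀ {l m k} {Q : Fin l → Permutation′ m → Set} →
                      (∀ q → HasCardinality (Perms (Q q)) k) →
                      HasCardinality (IndexedPerms Q) (l * k)
cardinality-indexed {l} {m} {k} {Q} h = Inverse.trans pairs (Inverse.sym *↔×)
  where
  pairs : Inverse (IndexedPerms Q) (≡.setoid (Fin l × Fin k))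
  pairs = record
    { to        = λ ((q , ρ) , x) → q , Inverse.to (h q) (ρ , x)
    ; from      = λ (q , i) → let ρ , x = Inverse.from (h q) i in (q , ρ) , x
    ; to-cong   = λ { {(q , _) , _} (refl , e) → cong (q ,_) (Inverse.to-cong (h q) e) }
    ; from-cong = λ { {q , _} refl → refl , λ _ → refl }
    ; inverse   = (λ { {q , _} (refl , e) → cong (q ,_) (Inverse.inverseˡ (h q) e) })
                , (λ { {(q , _) , _} refl → refl , Inverse.inverseʳ (h q) refl })
    }

-- The bijection behind the recursion.

module _ {m} {P : ℕ → Set} (P? : Decidable P) (a : Fin (suc m)) {w : Fin (suc m) → ℕ}
         {u : Fin m → ℕ} {v : Fin m → Fin m → ℕ}
         (u≡ : ∀ x → u x ≡ w (punchIn a x))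
         (v-q : ∀ q → v q q ≡ w (punchIn a q) + w a)
         (v-else : ∀ q x → x ≢ q → v q x ≡ w (punchIn a x))
         where

  private
    Fixing : Permutation′ m → Set
    Fixing ρ = P (w a) × Balanced P u ρ

    Moving : Fin m → Permutation′ m → Set
    Moving q ρ = Balanced P (v q) ρ

  -- Permutations are sorted by the preimage of `a`: either `a` itself, whose weight must then
  -- satisfy `P` alone, or `punchIn a q`, in which case `q` takes over the weight of `a`.
  splice-bijection : Bijection (⊎-setoid (Perms Fixing) (IndexedPerms Moving))
                               (Perms (Balanced P w))
  splice-bijection = record
    { to        = to
    ; cong      = to-cong
    ; bijective = (λ {x} {y} → injective x y) , λ π → let x , e = surjective π in
                    x , λ {z} z≈x i → trans (to-cong {z} {x} z≈x i) (e i)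
    }
    where
    open Setoid (⊎-setoid (Perms Fixing) (IndexedPerms Moving)) using (Carrier) renaming (_≈_ to _≋_)

    to : Carrier → Σ (Permutation′ (suc m)) (Balanced P w)
    to (inj₁ (ρ , h))       = splice a a ρ , extend-balanced (splice a a ρ) ρ (splice-fixed a ρ) u≡ h
    to (inj₂ ((q , ρ) , h)) = splice a (punchIn a q) ρ ,
      insert-balanced (splice a (punchIn a q) ρ) ρ (splice-cycle a q ρ) (v-q q) (v-else q) h

    to-cong : ∀ {x y} → x ≋ y → proj₁ (to x) ≈ proj₁ (to y)
    to-cong (inj₁ {ρ , _} {σ , _} e) = splice-cong a a {ρ} {σ} e
    to-cong (inj₂ {(q , ρ) , _} {(_ , σ) , _} (refl , e)) = splice-cong a (punchIn a q) {ρ} {σ} e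

    injective : ∀ x y → proj₁ (to x) ≈ proj₁ (to y) → x ≋ y
    injective (inj₁ (ρ , _)) (inj₁ (σ , _)) e = inj₁ (splice-injective a a {ρ} {σ} e)
    injective (inj₁ (ρ , _)) (inj₂ ((q , σ) , _)) e =
      contradiction (sym (splice-injective-point a {ρ = ρ} {σ} e)) (punchInᵢ≢i a q)
    injective (inj₂ ((q , ρ) , _)) (inj₁ (σ , _)) e =
      contradiction (splice-injective-point a {ρ = ρ} {σ} e) (punchInᵢ≢i a q)
    injective (inj₂ ((q , ρ) , _)) (inj₂ ((q′ , σ) , _)) e
      with refl ← punchIn-injective a q q′ (splice-injective-point a {ρ = ρ} {σ} e) =
      inj₂ (refl , splice-injective a (punchIn a q) {ρ} {σ} e)

    surjective : ∀ π → ∃ λ x → proj₁ (to x) ≈ proj₁ π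
    -- The preimage of `a` is abstracted jointly, so that the view also refines the type of
    -- `splice-surjective a π`.
    surjective (π , b) with π ⟨$⟩ˡ a | punchView a (π ⟨$⟩ˡ a) | splice-surjective a π
    ... | _ | hit    | ρ , e =
      inj₁ (ρ , restrict-balanced (splice a a ρ) ρ (splice-fixed a ρ) u≡
                  (balanced-cong π (splice a a ρ) (sym ∘ e) b)) , e
    ... | _ | miss q | ρ , e =
      inj₂ ((q , ρ) , contract-balanced (splice a (punchIn a q) ρ) ρ (splice-cycle a q ρ)
                        (v-q q) (v-else q)
                        (balanced-cong π (splice a (punchIn a q) ρ) (sym ∘ e) b)) , e

  cardinality-step : ∀ {k l} → HasCardinality (Perms (Balanced P u)) k →
                     (∀ q → HasCardinality (Perms (Balanced P (v q))) l) →
                     HasCardinality (Perms (Balanced P w))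
                       ((if does (P? (w a)) then k else 0) + m * l)
  cardinality-step {k} hk hl =
    Inverse.trans (Inverse.sym (Bijection⇒Inverse splice-bijection))
      (cardinality-⊎ fixing (cardinality-indexed hl))
    where
    fixing : HasCardinality (Perms Fixing) (if does (P? (w a)) then k else 0)
    fixing with P? (w a)
    ... | yes p = Inverse.trans (perms-⇔ (λ _ → proj₂) (λ _ → p ,_)) hk
    ... | no ¬p = cardinality-none (λ _ → ¬p ∘ proj₁)

-- Counting permutations by the recursion.

module Count {P : ℕ → Set} (P? : Decidable P) where

  -- Here marked m j counts permutations of suc m points, one of weight j.
  mutual
    total : ℕ → ℕ
    total zero    = 1
    total (suc m) = marked m 1

    marked : ℕ → ℕ → ℕ
    marked zero    j = if does (P? j) then 1 else 0
    marked (suc m) j = (if does (P? j) then marked m 1 else 0) + suc m * marked m (suc j)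

  marked-accept : ∀ m {j t} → P j → marked m (suc j) ≡ t →
                  marked (suc m) j ≡ total (suc m) + suc m * t
  marked-accept _ {j} p refl rewrite dec-true (P? j) p = refl

  marked-reject : ∀ m {j t} → ¬ P j → marked m (suc j) ≡ t →
                  marked (suc m) j ≡ suc m * t
  marked-reject _ {j} ¬p refl rewrite dec-false (P? j) ¬p = refl

  -- The weight `j` enters the recursion only through the truth of `P`, so a period of `P` is a
  -- period in `j`.
  marked-periodic : ∀ {r} → (∀ j → does (P? (r + j)) ≡ does (P? j)) →
                    ∀ m j → marked m (r + j) ≡ marked m j
  marked-periodic h zero    j rewrite h j = refl
  marked-periodic {r} h (suc m) j
    rewrite h j | sym (+-suc r j) | marked-periodic h m (suc j) = refl

  mark : ∀ {m} → Fin m → ℕ → Fin m → ℕ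
  mark a j x = if does (x ≟ a) then j else 1

  mark-self : ∀ {m} (a : Fin m) j → mark a j a ≡ j
  mark-self a j rewrite dec-true (a ≟ a) refl = refl

  mark-other : ∀ {m} {a : Fin m} {j} x → x ≢ a → mark a j x ≡ 1
  mark-other {a = a} x x≢a rewrite dec-false (x ≟ a) x≢a = refl

  -- The condition on `w` covers both weightings left after deleting `a`: all weights 1 if `a` was
  -- fixed, or a new marked point `q` of weight `suc (w a)`.
  cardinality-marked : ∀ m (a : Fin (suc m)) w → (∀ x → x ≢ a → w x ≡ 1) →
                       HasCardinality (Perms (Balanced P w)) (marked m (w a))
  cardinality-marked zero a w w≡1 =
    subst (HasCardinality _) (+-identityʳ _)
      -- A lone point has no other predecessor: `l` is multiplied by 0, and its value is an
      -- arbitrary choice.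
      (cardinality-step P? a {u = const 1} {v = λ _ _ → 1} (λ ()) (λ ()) (λ ()) {l = 0}
        (cardinality-one (λ π ())) (λ ()))
  cardinality-marked (suc m) a w w≡1 =
    cardinality-step P? a {u = const 1} {v = λ q → mark q (suc (w a))}
      (λ x → sym (w≡1 _ (punchInᵢ≢i a x)))
      (λ q → trans (mark-self q _) (cong (_+ w a) (sym (w≡1 _ (punchInᵢ≢i a q)))))
      (λ q x x≢q → trans (mark-other x x≢q) (sym (w≡1 _ (punchInᵢ≢i a x))))
      -- When all weights are 1 any point may count as marked.
      (cardinality-marked m 0F (const 1) (λ _ _ → refl))
      (λ q → subst (λ j → HasCardinality (Perms (Balanced P (mark q (suc (w a))))) (marked m j))
        (mark-self q _) (cardinality-marked m q _ mark-other))

  cardinality-total : ∀ n → HasCardinality (Perms (Balanced {n} P (const 1))) (total n)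
  cardinality-total zero    = cardinality-one (λ π ())
  cardinality-total (suc m) = cardinality-marked m 0F (const 1) (λ _ _ → refl)

-- Residues modulo `r`.

-- Says that `m` leaves remainder `s` modulo `r`. Building it along the successors of `m` lets
-- induction on it follow the recursion of `marked`.
data Residue (r : ℕ) : ℕ → ℕ → Set where
  zero : Residue r 0 0
  next : ∀ {m s} → suc s < r → Residue r m s → Residue r (suc m) (suc s)
  wrap : ∀ {m s} → suc s ≡ r → Residue r m s → Residue r (suc m) 0

module Compare (r : ℕ) (2≤r : 2 ≤ r) where

  module C = Count (r ∣?_)
  module R = Count (λ s → ¬? (r ∣? s))

  private
    0<r : 0 < r
    0<r = ≤-trans (s≤s z≤n) 2≤r

  residue : ∀ m → ∃ λ s → s < r × Residue r m s
  residue zero = 0 , 0<r , zero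
  residue (suc m) with s , s<r , ρ ← residue m | suc s ℕ.≟ r
  ... | yes e = 0 , 0<r , wrap e ρ
  ... | no ne = let lt = ≤∧≢⇒< s<r ne in suc s , lt , next lt ρ

  residue-quotient : ∀ {m s} → Residue r m s → ∃ λ k → m ≡ k * r + s
  residue-quotient zero = 0 , refl
  residue-quotient (next {s = s} _ ρ) with k , refl ← residue-quotient ρ =
    k , sym (+-suc (k * r) s)
  residue-quotient (wrap {s = s} refl ρ) with k , refl ← residue-quotient ρ =
    suc k , (begin
      suc (k * r + s)     ≡⟨ +-suc (k * r) s ⟨
      k * r + r           ≡⟨ +-comm (k * r) r ⟩
      r + k * r           ≡⟨ +-identityʳ _ ⟨
      r + k * r + 0       ∎)
    where open ≡-Reasoning

  ∣⇒residue-zero : ∀ {m} → r ∣ m → Residue r m 0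
  ∣⇒residue-zero {m} r∣m with residue m
  ... | zero  , _   , ρ = ρ
  ... | suc s , s<r , ρ with k , refl ← residue-quotient ρ =
    contradiction (∣m+n∣m⇒∣n r∣m (n∣m*n k)) (>⇒∤ s<r)

  -- Periodicity in the weight and the regular totals.

  private
    shift : ∀ j → does (r ∣? (r + j)) ≡ does (r ∣? j)
    shift j = does-⇔
      (mk⇔ (λ d → ∣m+n∣m⇒∣n d ∣-refl) (∣m∣n⇒∣m+n ∣-refl))
      (r ∣? (r + j)) (r ∣? j)

    suc≡+1 : suc r ≡ r + 1
    suc≡+1 = sym (+-comm r 1)

  regular-period : ∀ m → R.marked m (suc r) ≡ R.total (suc m)
  regular-period m = trans (cong (R.marked m) suc≡+1)
    (R.marked-periodic (cong not ∘ shift) m 1)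

  cyclic-period : ∀ m → C.marked m (suc r) ≡ C.total (suc m)
  cyclic-period m = trans (cong (C.marked m) suc≡+1) (C.marked-periodic shift m 1)

  -- A marked point of weight `r` cannot be alone, so one of the `m` others precedes it; that one
  -- then has weight `suc r`, which counts like 1.
  regular-at-r : ∀ m → R.marked m r ≡ m * R.total m
  regular-at-r zero rewrite dec-true (r ∣? r) ∣-refl = refl
  regular-at-r (suc m) = R.marked-reject m (λ r∤r → r∤r ∣-refl) (regular-period m)

  -- Being alone is now allowed and contributes one further copy of the total to the `m` choices of
  -- a predecessor.
  cyclic-at-r : ∀ m → C.marked m r ≡ suc m * C.total m
  cyclic-at-r zero rewrite dec-true (r ∣? r) ∣-refl = refl
  cyclic-at-r (suc m) = C.marked-accept m ∣-refl (cyclic-period m)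

  mutual
    -- Each recursion step lowers `m` and raises the weight, keeping residue plus weight fixed until
    -- the residue wraps. Whether that sum is below `r` decides between the factors `suc m` and `m`.
    regular-below : ∀ {m s i} → Residue r m s → s + suc i < r →
                    R.marked m (suc i) ≡ suc m * R.total m
    regular-below {i = i} zero lt
      rewrite dec-false (r ∣? suc i) (>⇒∤ lt) = refl
    regular-below {suc m} {suc s} {i} (next s<r ρ) lt = begin
      R.marked (suc m) (suc i)
        ≡⟨ R.marked-accept m (>⇒∤ i<r) (regular-below ρ s+i<r) ⟩
      R.total (suc m) + suc m * (suc m * R.total m)
        ≡⟨ cong (λ t → R.total (suc m) + suc m * t) (total-next ρ s<r) ⟨
      suc (suc m) * R.total (suc m)
        ∎
      where
      open ≡-Reasoning
      s+i<r : s + suc (suc i) < r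
      s+i<r = subst (_< r) (sym (+-suc s (suc i))) lt
      i<r : suc i < r
      i<r = m+n≤o⇒n≤o s (<⇒≤ s+i<r)
    -- Going down from a multiple of `r`, the residue jumps from 0 to `r` - 1, so residue plus
    -- weight grows by `r`.
    regular-below {suc m} {0} {i} (wrap {s = s} refl ρ) lt = begin
      R.marked (suc m) (suc i)
        ≡⟨ R.marked-accept m (>⇒∤ lt) (regular-above ρ r≤s+i lt) ⟩
      R.total (suc m) + suc m * (m * R.total m)
        ≡⟨ cong (λ t → R.total (suc m) + suc m * t) (total-wrap ρ refl) ⟨
      suc (suc m) * R.total (suc m)
        ∎
      where
      open ≡-Reasoning
      r≤s+i : r ≤ s + suc (suc i)
      r≤s+i = subst (r ≤_) (sym (+-suc s (suc i))) (s≤s (m≤m+n s (suc i)))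

    -- Since residue plus weight is at least `r`, the weight climbs to `r` no later than the residue
    -- falls to 0, and `regular-at-r` ends the descent.
    regular-above : ∀ {m s i} → Residue r m s → r ≤ s + suc i → suc i ≤ r →
                    R.marked m (suc i) ≡ m * R.total m
    regular-above {m} {s} {i} ρ ge le with suc i ℕ.≟ r
    ... | yes refl = regular-at-r m
    regular-above zero       ge le | no ne = contradiction (≤-antisym le ge) ne
    regular-above (wrap _ _) ge le | no ne = contradiction (≤-antisym le ge) ne
    regular-above {suc m} {suc s} {i} (next s<r ρ) ge le | no ne = begin
      R.marked (suc m) (suc i)
        ≡⟨ R.marked-accept m (>⇒∤ i<r) (regular-above ρ r≤s+i i<r) ⟩
      R.total (suc m) + suc m * (m * R.total m)
        ≡⟨ cong (R.total (suc m) +_) (x∙yz≈y∙xz (suc m) m (R.total m)) ⟩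
      R.total (suc m) + m * (suc m * R.total m)
        ≡⟨ cong (λ t → R.total (suc m) + m * t) (total-next ρ s<r) ⟨
      suc m * R.total (suc m)
        ∎
      where
      open ≡-Reasoning
      i<r : suc i < r
      i<r = ≤∧≢⇒< le ne
      r≤s+i : r ≤ s + suc (suc i)
      r≤s+i = subst (r ≤_) (sym (+-suc s (suc i))) ge

    -- This and `total-wrap` are the case of weight 1, as `total (suc m)` is `marked m 1`.
    total-next : ∀ {m s} → Residue r m s → suc s < r → R.total (suc m) ≡ suc m * R.total m
    total-next {_} {s} ρ lt = regular-below ρ (subst (_< r) (+-comm 1 s) lt)

    total-wrap : ∀ {m s} → Residue r m s → suc s ≡ r → R.total (suc m) ≡ m * R.total m
    total-wrap {_} {s} ρ e = regular-above ρ (≤-reflexive (trans (sym e) (+-comm 1 s))) 0<r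

  total-positive : ∀ m → 0 < R.total m
  total-positive zero          = s≤s z≤n
  total-positive (suc zero) rewrite dec-false (r ∣? 1) (>⇒∤ 2≤r) = s≤s z≤n
  total-positive (suc (suc m)) = subst (0 <_) (sym (R.marked-accept m (>⇒∤ 2≤r) refl))
    (≤-trans (total-positive (suc m)) (m≤m+n _ _))

  -- The cyclic totals and their comparison with the regular ones.

  -- The total weight `m + j` is a sum of cycle weights. In the recursion one summand splits off a
  -- multiple `j` of `r`, and the other leaves the total weight unchanged.
  cyclic-vanishes : ∀ m j → r ∤ m + j → C.marked m j ≡ 0
  cyclic-vanishes zero j r∤j rewrite dec-false (r ∣? j) r∤j = refl
  cyclic-vanishes (suc m) j r∤ with r ∣? j
  ... | no r∤j = trans (cong (suc m *_) ih) (*-zeroʳ (suc m))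
    where ih = cyclic-vanishes m (suc j) (r∤ ∘ subst (r ∣_) (+-suc m j))
  ... | yes r∣j = cong₂ _+_
    (cyclic-vanishes m 1 (λ d → r∤ (∣m∣n⇒∣m+n (subst (r ∣_) (+-comm m 1) d) r∣j)))
    (trans (cong (suc m *_) ih) (*-zeroʳ (suc m)))
    where ih = cyclic-vanishes m (suc j) (r∤ ∘ subst (r ∣_) (+-suc m j))

  total-cyclic-vanishes : ∀ n → r ∤ n → C.total n ≡ 0
  total-cyclic-vanishes zero    r∤n = contradiction (divides-refl 0) r∤n
  total-cyclic-vanishes (suc m) r∤n =
    cyclic-vanishes m 1 (r∤n ∘ subst (r ∣_) (+-comm m 1))

  private
    complement-∤ : ∀ {s j} → suc s < r → suc s + j ≡ r → r ∤ j
    complement-∤ {s} {zero}  lt e = contradiction (trans (sym (+-identityʳ (suc s))) e) (<⇒≢ lt)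
    complement-∤ {s} {suc j} lt e = >⇒∤ (subst (suc (suc j) ≤_) e (s≤s (m≤n+m (suc j) s)))

  mutual
    -- Just below a positive multiple of `r` the residue is `r` - 1, which weight 1 completes to
    -- `r`; the bound of `marked-≤` is then the regular total given by `total-wrap`.
    total-≤ : ∀ {m} → Residue r m 0 → C.total m ≤ R.total m
    total-≤ zero = ≤-refl
    total-≤ (wrap {s = zero} e ρ) = contradiction (sym e) (<⇒≢ 2≤r ∘ sym)
    total-≤ {suc m} (wrap {s = suc s} e ρ) = subst (C.total (suc m) ≤_) (sym (total-wrap ρ e))
      (marked-≤ ρ (trans (+-comm (suc s) 1) e))

    -- With `m + j` fixed, the descent goes through the residues down to 1. There `suc j` is `r`,
    -- and `cyclic-at-r` leads back to the totals at the previous multiple of `r`.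
    marked-≤ : ∀ {m s j} → Residue r m (suc s) → suc s + j ≡ r →
               C.marked m j ≤ m * R.total m
    marked-≤ {suc m} {zero} {j} (next lt ρ) e = begin
      C.marked (suc m) j               ≡⟨ C.marked-reject m (complement-∤ lt e) at-r ⟩
      suc m * (suc m * C.total m)      ≤⟨ *-monoʳ-≤ (suc m) (*-monoʳ-≤ (suc m) (total-≤ ρ)) ⟩
      suc m * (suc m * R.total m)      ≡⟨ cong (suc m *_) (total-next ρ lt) ⟨
      suc m * R.total (suc m)          ∎
      where
      open ≤-Reasoning
      at-r : C.marked m (suc j) ≡ suc m * C.total m
      at-r = trans (cong (C.marked m) e) (cyclic-at-r m)
    marked-≤ {s = suc s} ρ e = <⇒≤ (marked-< ρ e)

    -- From residue 2 on, the inductive bound carries a factor `m` where `total-next` supplies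
    -- `suc m`; positivity of the regular total makes the gap strict.
    marked-< : ∀ {m s j} → Residue r m (suc (suc s)) → suc (suc s) + j ≡ r →
               C.marked m j < m * R.total m
    marked-< {suc m} {s} {j} (next lt ρ) e = begin-strict
      C.marked (suc m) j               ≡⟨ C.marked-reject m (complement-∤ lt e) refl ⟩
      suc m * C.marked m (suc j)       ≤⟨ *-monoʳ-≤ (suc m) bound ⟩
      suc m * (m * R.total m)          <⟨ *-monoʳ-< (suc m) (m<n+m _ (total-positive m)) ⟩
      suc m * (suc m * R.total m)      ≡⟨ cong (suc m *_) (total-next ρ lt) ⟨
      suc m * R.total (suc m)          ∎
      where
      open ≤-Reasoning
      bound : C.marked m (suc j) ≤ m * R.total m
      bound = marked-≤ ρ (trans (+-suc (suc s) j) e)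

  -- The residue before wrapping is `r` - 1. If it is at least 2 the inequality is strict, so
  -- equality leaves only residue 1.
  total-≡ : ∀ {m} → Residue r (suc m) 0 → C.total (suc m) ≡ R.total (suc m) → r ≡ 2
  total-≡ (wrap {s = zero} e ρ) _ = contradiction e (<⇒≢ 2≤r)
  total-≡ (wrap {s = suc zero} e ρ) _ = sym e
  total-≡ (wrap {s = suc (suc s)} e ρ) c≡d = contradiction (trans c≡d (total-wrap ρ e))
    (<⇒≢ (marked-< ρ (trans (+-comm (suc (suc s)) 1) e)))

  -- Cardinalities of both sets and the final comparison.

  cardinality-Cyc : ∀ n → HasCardinality (Cyc r n) (C.total n)
  cardinality-Cyc n = Inverse.trans (perms-⇔ cycles⇒balanced balanced⇒cycles)
    (C.cardinality-total n)

  cardinality-Reg : ∀ n → HasCardinality (Reg r n) (R.total n)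
  cardinality-Reg n = Inverse.trans (perms-⇔ cycles⇒balanced balanced⇒cycles)
    (R.cardinality-total n)

theorem3p4 : ∀ (r n : ℕ) → 2 ≤ r → 1 ≤ n →
    ∃₂ λ c d →
    HasCardinality (Cyc r n) c × HasCardinality (Reg r n) d ×
    c ≤ d × (c ≡ d → r ≡ 2 × 2 ∣ n)
theorem3p4 r n@(suc _) 2≤r _ =
  C.total n , R.total n , cardinality-Cyc n , cardinality-Reg n , comparison
  where
  open Compare r 2≤r

  comparison : C.total n ≤ R.total n × (C.total n ≡ R.total n → r ≡ 2 × 2 ∣ n)
  comparison with r ∣? n
  -- The cyclic total is 0 and the regular total positive, so equality is impossible here.
  ... | no r∤n = subst (_≤ R.total n) (sym c≡0) z≤n ,
                 λ c≡d → contradiction (trans (sym c≡0) c≡d) (<⇒≢ (total-positive n))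
    where c≡0 = total-cyclic-vanishes n r∤n
  ... | yes r∣n = total-≤ ρ , λ c≡d → let r≡2 = total-≡ ρ c≡d in
                    r≡2 , subst (_∣ n) r≡2 r∣n
    where ρ = ∣⇒residue-zero r∣n
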